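{- For every integer $s\ge1$ one has $L_s<1$, where $L_s=T^{n,n-s}_{s,1,L}$ (for $n\ge 4s$) is the label of the left side of the triangle in row $s$ and diagonal $1$ of the grid $T^{n,n-s}$ obtained from the all-ones $n$-grid by $s$ reductions.
   Context: Labeled grids. An $N$-grid is the triangular grid graph with $N$ rows of upright triangles. The upright triangles are $T_{r,d}$ with $1\le d\le r\le N$ ($r$ is the row, counted from the top; $d$ is the diagonal, counted from the left). Each edge of the grid is a side of exactly one upright triangle, and the left, right and base sides of $T_{r,d}$ are denoted $T_{r,d,L},T_{r,d,R},T_{r,d,B}$. The bottom-right vertex of $T_{r,d}$, the bottom-left vertex of $T_{r,d+1}$ and the top vertex of $T_{r+1,d+1}$ coincide (whenever these exist). A labeled $N$-grid assigns a positive real number (resistance) to each edge; the symbol $T_{r,d,X}$, $X\in\{L,R,B\}$, also denotes this label. Reduction. For positive reals put $\Delta(x,y,z)=\frac{xy}{x+y+z}$ and $Y(x,y,z)=\frac{xy+yz+zx}{x}$. The reduction of a labeled $N$-grid ($N\ge2$) is a labeled $(N-1)$-grid obtained by applying $\Delta$–Y transformations to all upright triangles, discarding the three corner tails, making series transformations along the boundary and Y–$\Delta$ transformations in the interior. Explicitly, if $T_{r,d}$ has labels $(l,\rho,b)$ on its (left, right, base) sides, set $Y_{12,r,d}=\Delta(l,\rho,b)$, $Y_{8,r,d}=\Delta(b,l,\rho)$, $Y_{4,r,d}=\Delta(\rho,b,l)$. The reduced grid has, for $1\le d\le r\le N-1$, labels left: $Y_{8,r,1}+Y_{12,r+1,1}$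 if $d=1$, and $Y(Y_{4,r,d-1},Y_{8,r,d},Y_{12,r+1,d})$ if $d\ge2$; right: $Y_{4,r,r}+Y_{12,r+1,r+1}$ if $d=r$, and $Y(Y_{8,r,d+1},Y_{12,r+1,d+1},Y_{4,r,d})$ if $d\le r-1$; base: $Y_{4,N,d}+Y_{8,N,d+1}$ if $r=N-1$, and $Y(Y_{12,r+2,d+1},Y_{4,r+1,d},Y_{8,r+1,d+1})$ if $r\le N-2$. $T^{n}=T^{n,n}$ is the $n$-grid with all labels equal to $1$, and $T^{n,m}$ (for $1\le m\le n$) is the labeled $m$-grid obtained from it by $n-m$ successive reductions. $T^{n,m}_{r,d,X}$ is the label of side $X$ of its triangle in row $r$ and diagonal $d$. As the notation $L_s$ indicates, the value $T^{n,n-s}_{s,1,L}$ is the same for all $n\ge4s$. -}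

module Defs where

open import Data.Nat.Base as ℕ using (ℕ; zero; suc; s≤s; z≤n; _≤‴_; ≤‴-refl; ≤‴-step)
import Data.Nat.Properties as ℕ
open import Data.Rational.Base as ℚ using (ℚ; 1ℚ)
import Data.Rational.Properties as ℚ
open import Relation.Nullary.Decidable.Core using (yes; no)

-- The formulas for Δ and Y and the all-ones grid never leave the positive
-- rationals, so these serve as labels in place of the positive reals.
record ℚ⁺ : Set where
  constructor mkℚ⁺
  field
    value     : ℚ
    .positive : ℚ.Positive value

open ℚ⁺ public using (value)

infixl 6 _+_
infixl 7 _*_ _÷_

1ℚ⁺ : ℚ⁺
1ℚ⁺ = mkℚ⁺ 1ℚ _

_+_ : ℚ⁺ → ℚ⁺ → ℚ⁺
mkℚ⁺ p p>0 + mkℚ⁺ q q>0 =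
  mkℚ⁺ (p ℚ.+ q) (ℚ.pos+pos⇒pos p {{p>0}} q {{q>0}})

_*_ : ℚ⁺ → ℚ⁺ → ℚ⁺
mkℚ⁺ p p>0 * mkℚ⁺ q q>0 =
  mkℚ⁺ (p ℚ.* q) (ℚ.pos*pos⇒pos p {{p>0}} q {{q>0}})

_÷_ : ℚ⁺ → ℚ⁺ → ℚ⁺
mkℚ⁺ p p>0 ÷ mkℚ⁺ q q>0 =
  mkℚ⁺ ((p ℚ.÷ q) {{ℚ.pos⇒nonZero q {{q>0}}}})
       (ℚ.pos*pos⇒pos p {{p>0}} ((ℚ.1/ q) {{ℚ.pos⇒nonZero q {{q>0}}}})
                                {{ℚ.1/pos⇒pos q {{q>0}}}})

Δ : ℚ⁺ → ℚ⁺ → ℚ⁺ → ℚ⁺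
Δ x y z = (x * y) ÷ (x + y + z)

Y : ℚ⁺ → ℚ⁺ → ℚ⁺ → ℚ⁺
Y x y z = (x * y + y * z + z * x) ÷ x

-- Upright triangles of the N-grid. The bounds are irrelevant, so a triangle
-- is determined by its row and diagonal.
record Upright (N : ℕ) : Set where
  constructor tri
  field
    row      : ℕ
    diagonal : ℕ
    .1≤d     : 1 ℕ.≤ diagonal
    .d≤r     : diagonal ℕ.≤ row
    .r≤N     : row ℕ.≤ N

data Side : Set where
  L R B : Side

-- Each edge of the grid is a side of exactly one upright triangle.
Grid : ℕ → Set
Grid N = Upright N → Side → ℚ⁺

module _ {N : ℕ} (G : Grid N) where

  Y₁₂ Y₈ Y₄ : (r d : ℕ) → .(1 ℕ.≤ d) → .(d ℕ.≤ r) → .(r ℕ.≤ N) → ℚ⁺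
  Y₁₂ r d p q b = let t = tri r d p q b in Δ (G t L) (G t R) (G t B)
  Y₈  r d p q b = let t = tri r d p q b in Δ (G t B) (G t L) (G t R)
  Y₄  r d p q b = let t = tri r d p q b in Δ (G t R) (G t B) (G t L)

-- N is the size of the reduced grid, so the formulas below use rows up to
-- suc N. For N = 0 the result is the empty grid.
reduce : {N : ℕ} → Grid (suc N) → Grid N
reduce {N} G (tri r (suc zero) p q b) L =
    Y₈  G r       1 p q (ℕ.m≤n⇒m≤1+n b)
  + Y₁₂ G (suc r) 1 p (ℕ.m≤n⇒m≤1+n q) (s≤s b)
reduce {N} G (tri r (suc (suc e)) p q b) L =
  Y (Y₄  G r       (suc e)       (s≤s z≤n) (ℕ.<⇒≤ q) (ℕ.m≤n⇒m≤1+n b))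
    (Y₈  G r       (suc (suc e)) p q (ℕ.m≤n⇒m≤1+n b))
    (Y₁₂ G (suc r) (suc (suc e)) p (ℕ.m≤n⇒m≤1+n q) (s≤s b))
reduce {N} G (tri r d p q b) R with d ℕ.<? r
... | yes d<r =
  Y (Y₈  G r       (suc d) (s≤s z≤n) d<r (ℕ.m≤n⇒m≤1+n b))
    (Y₁₂ G (suc r) (suc d) (s≤s z≤n) (s≤s q) (s≤s b))
    (Y₄  G r       d       p q (ℕ.m≤n⇒m≤1+n b))
... | no _ =  -- here d = r
    Y₄  G r       r       (ℕ.≤-trans p q) ℕ.≤-refl (ℕ.m≤n⇒m≤1+n b)
  + Y₁₂ G (suc r) (suc r) (s≤s z≤n) ℕ.≤-refl (s≤s b)
reduce {N} G (tri r d p q b) B with r ℕ.<? N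
... | yes r<N =
  Y (Y₁₂ G (suc (suc r)) (suc d) (s≤s z≤n) (s≤s (ℕ.m≤n⇒m≤1+n q)) (s≤s r<N))
    (Y₄  G (suc r)       d       p (ℕ.m≤n⇒m≤1+n q) (s≤s b))
    (Y₈  G (suc r)       (suc d) (s≤s z≤n) (s≤s q) (s≤s b))
... | no _ =  -- here r = N, the last row of the reduced grid
    Y₄ G (suc N) d       p (ℕ.m≤n⇒m≤1+n (ℕ.≤-trans q b)) ℕ.≤-refl
  + Y₈ G (suc N) (suc d) (s≤s z≤n) (s≤s (ℕ.≤-trans q b)) ℕ.≤-refl

ones : (n : ℕ) → Grid n
ones _ _ _ = 1ℚ⁺

reduceTo : {n m : ℕ} → m ≤‴ n → Grid n → Grid m
reduceTo ≤‴-refl         G = G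
reduceTo (≤‴-step 1+m≤n) G = reduce (reduceTo 1+m≤n G)

-- T n m is the grid with m rows obtained from the all-ones n-grid by n ∸ m
-- reductions.
T : (n m : ℕ) → m ℕ.≤ n → Grid m
T n m m≤n = reduceTo (ℕ.≤⇒≤‴ m≤n) (ones n)

4s≤n⇒s≤n∸s : {s n : ℕ} → 4 ℕ.* s ℕ.≤ n → s ℕ.≤ n ℕ.∸ s
4s≤n⇒s≤n∸s {s} 4s≤n =
  ℕ.m+n≤o⇒m≤o∸n s (ℕ.≤-trans (ℕ.+-monoʳ-≤ s (ℕ.m≤m+n s _)) 4s≤n)

{-# OPTIONS --safe #-}

-- Far from the right and base boundaries the labels do not depend on the row,
-- and there the right and base labels agree. With left label l and right and
-- base labels b, a reduction replaces the left label on the boundary by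
-- 2lb / (l + 2b), which is less than l.
module Submission where

open import Defs
open import Data.Nat.Base using (ℕ; _≤_; _∸_) renaming (_*_ to _*ℕ_)
open import Data.Nat.Properties using (m∸n≤m; ≤-refl)
open import Data.Rational.Base using (1ℚ) renaming (_<_ to _<ℚ_)

open import Data.Nat.Base as ℕ
  using (suc; s≤s; z≤n; _≤‴_; ≤‴-refl; ≤‴-step)
import Data.Nat.Properties as ℕ
open import Data.Product.Base using (_×_; _,_)
import Data.Rational.Base as ℚ
import Data.Rational.Properties as ℚ
open import Relation.Binary.PropositionalEquality
open import Relation.Nullary.Decidable.Core using (yes; no)
open import Relation.Nullary.Negation.Core using (contradiction)

-- Arithmetic of positive rationals and the decrease of the boundary label.

value-injective : ∀ {x y} → value x ≡ value y → x ≡ y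
value-injective refl = refl

+-comm : ∀ x y → x + y ≡ y + x
+-comm x y = value-injective (ℚ.+-comm (value x) (value y))

+-assoc : ∀ x y z → x + y + z ≡ x + (y + z)
+-assoc x y z = value-injective (ℚ.+-assoc (value x) (value y) (value z))

*-comm : ∀ x y → x * y ≡ y * x
*-comm x y = value-injective (ℚ.*-comm (value x) (value y))

*-distribˡ-+ : ∀ x y z → x * (y + z) ≡ x * y + x * z
*-distribˡ-+ x y z =
  value-injective (ℚ.*-distribˡ-+ (value x) (value y) (value z))

÷-distribʳ-+ : ∀ z x y → (x + y) ÷ z ≡ x ÷ z + y ÷ z
÷-distribʳ-+ (mkℚ⁺ z z>0) x y =
  value-injective (ℚ.*-distribʳ-+ (ℚ.1/ z) (value x) (value y))
  where instance _ = ℚ.pos⇒nonZero z {{z>0}}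

x*y÷y≡x : ∀ x y → x * y ÷ y ≡ x
x*y÷y≡x x (mkℚ⁺ y y>0) = value-injective (begin
  value x ℚ.* y ℚ.* ℚ.1/ y    ≡⟨ ℚ.*-assoc (value x) y (ℚ.1/ y) ⟩
  value x ℚ.* (y ℚ.* ℚ.1/ y)  ≡⟨ cong (value x ℚ.*_) (ℚ.*-inverseʳ y) ⟩
  value x ℚ.* 1ℚ              ≡⟨ ℚ.*-identityʳ (value x) ⟩
  value x                     ∎)
  where
  open ≡-Reasoning
  instance _ = ℚ.pos⇒nonZero y {{y>0}}

x<y+x : ∀ x y → value x <ℚ value (y + x)
x<y+x x (mkℚ⁺ y y>0) = begin-strict
  value x          ≡⟨ ℚ.+-identityˡ (value x) ⟨
  ℚ.0ℚ ℚ.+ value x <⟨ ℚ.+-monoˡ-< (value x) (ℚ.positive⁻¹ y {{y>0}}) ⟩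
  y ℚ.+ value x    ∎
  where open ℚ.≤-Reasoning

Δ-swap : ∀ x y z → Δ x y z ≡ Δ y x z
Δ-swap x y z = cong₂ (λ p q → p ÷ (q + z)) (*-comm x y) (+-comm x y)

Y-swap : ∀ x y z → Y x y z ≡ Y x z y
Y-swap x y z = cong (_÷ x) (begin
  x * y + y * z + z * x    ≡⟨ cong₂ _+_ (cong₂ _+_ (*-comm x y) (*-comm y z)) (*-comm z x) ⟩
  y * x + z * y + x * z    ≡⟨ +-comm (y * x + z * y) (x * z) ⟩
  x * z + (y * x + z * y)  ≡⟨ cong (x * z +_) (+-comm (y * x) (z * y)) ⟩
  x * z + (z * y + y * x)  ≡⟨ +-assoc (x * z) (z * y) (y * x) ⟨
  x * z + z * y + y * x    ∎)
  where open ≡-Reasoning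

-- With `s = l + b + b`, writing `l` as `l * s ÷ s` splits it into `l * l ÷ s` and two copies of
-- `l * b ÷ s`. Both Δ terms equal `l * b ÷ s`, so their sum falls short of `l` by the positive
-- `l * l ÷ s`.
Δ+Δ<l : ∀ l b → value (Δ b l b + Δ l b b) <ℚ value l
Δ+Δ<l l b =
  subst₂ _<ℚ_ (cong value Δ+Δ) (cong value split) (x<y+x (Δ l b b + Δ l b b) (l * l ÷ s))
  where
  open ≡-Reasoning
  s = l + b + b
  Δ+Δ : Δ l b b + Δ l b b ≡ Δ b l b + Δ l b b
  Δ+Δ = cong (_+ Δ l b b) (Δ-swap l b b)
  split : l * l ÷ s + (Δ l b b + Δ l b b) ≡ l
  split = begin
    l * l ÷ s + (Δ l b b + Δ l b b)  ≡⟨ +-assoc (l * l ÷ s) (Δ l b b) (Δ l b b) ⟨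
    l * l ÷ s + Δ l b b + Δ l b b    ≡⟨ cong (_+ Δ l b b) (÷-distribʳ-+ s (l * l) (l * b)) ⟨
    (l * l + l * b) ÷ s + Δ l b b    ≡⟨ ÷-distribʳ-+ s (l * l + l * b) (l * b) ⟨
    (l * l + l * b + l * b) ÷ s      ≡⟨ cong (λ t → (t + l * b) ÷ s) (*-distribˡ-+ l l b) ⟨
    (l * (l + b) + l * b) ÷ s        ≡⟨ cong (_÷ s) (*-distribˡ-+ l (l + b) b) ⟨
    l * s ÷ s                        ≡⟨ x*y÷y≡x l s ⟩
    l                                ∎

-- The stable region and how a reduction shrinks it.

-- The triangles with n − m + d ≤ r ≤ n − 2(n − m), stated without subtraction.
-- Here n − m is the number of reductions already made.
Region : (n m r d : ℕ) → Set
Region n m r d = (n ℕ.+ d ≤ r ℕ.+ m) × (r ℕ.+ n ≤ m ℕ.+ m)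

-- A reduced label at `(r , d)` reads old triangles in rows `r` to `2 + r` on diagonals up to
-- `suc d`. Passing from `m` to `suc m` relaxes the first bound by one and the second by two, which
-- pays for both shifts.
Region-shift : ∀ {n m r d r′ d′} → Region n m r d →
       d′ ≤ suc d → r ≤ r′ → r′ ≤ 2 ℕ.+ r → Region n (suc m) r′ d′
Region-shift {n} {m} {r} {d} {r′} {d′} (n+d≤r+m , r+n≤m+m) d′≤1+d r≤r′ r′≤2+r =
  (begin
    n ℕ.+ d′        ≤⟨ ℕ.+-monoʳ-≤ n d′≤1+d ⟩
    n ℕ.+ suc d     ≡⟨ ℕ.+-suc n d ⟩
    suc (n ℕ.+ d)   ≤⟨ s≤s n+d≤r+m ⟩
    suc (r ℕ.+ m)   ≤⟨ s≤s (ℕ.+-monoˡ-≤ m r≤r′) ⟩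
    suc (r′ ℕ.+ m)  ≡⟨ ℕ.+-suc r′ m ⟨
    r′ ℕ.+ suc m    ∎) ,
  (begin
    r′ ℕ.+ n         ≤⟨ ℕ.+-monoˡ-≤ n r′≤2+r ⟩
    2 ℕ.+ (r ℕ.+ n)  ≤⟨ s≤s (s≤s r+n≤m+m) ⟩
    2 ℕ.+ (m ℕ.+ m)  ≡⟨ cong suc (ℕ.+-suc m m) ⟨
    suc m ℕ.+ suc m  ∎)
  where open ℕ.≤-Reasoning

-- Together with `Region⇒r<m`, this keeps the region of a reduced grid off the right and base
-- boundaries, so `reduce` takes its Y-Δ branches there for the right and base labels.
Region⇒d<r : ∀ {n m r d} → m ℕ.< n → Region n m r d → d ℕ.< r
Region⇒d<r {n} {m} {r} {d} m<n (n+d≤r+m , _) = ℕ.+-cancelʳ-< m d r (begin-strict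
  d ℕ.+ m  ≡⟨ ℕ.+-comm d m ⟩
  m ℕ.+ d  <⟨ ℕ.+-monoˡ-< d m<n ⟩
  n ℕ.+ d  ≤⟨ n+d≤r+m ⟩
  r ℕ.+ m  ∎)
  where open ℕ.≤-Reasoning

Region⇒r<m : ∀ {n m r d} → m ℕ.< n → Region n m r d → r ℕ.< m
Region⇒r<m {n} {m} {r} m<n (_ , r+n≤m+m) =
  ℕ.+-cancelʳ-< m r m (ℕ.<-≤-trans (ℕ.+-monoʳ-< r m<n) r+n≤m+m)

-- One `b` serves both the right and the base sides. The bound on `l 1` is weak because the all-ones
-- grid attains it.
record RowInvariant (n m : ℕ) (G : Grid m) : Set where
  field
    l b  : ℕ → ℚ⁺
    l₁≤1 : value (l 1) ℚ.≤ 1ℚ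
    G-L  : ∀ r d .p .q .u → Region n m r d → G (tri r d p q u) L ≡ l d
    G-R  : ∀ r d .p .q .u → Region n m r d → G (tri r d p q u) R ≡ b d
    G-B  : ∀ r d .p .q .u → Region n m r d → G (tri r d p q u) B ≡ b d

Δ-cong : ∀ {x x′ y y′ z z′} → x ≡ x′ → y ≡ y′ → z ≡ z′ → Δ x y z ≡ Δ x′ y′ z′
Δ-cong refl refl refl = refl

Y-cong : ∀ {x x′ y y′ z z′} → x ≡ x′ → y ≡ y′ → z ≡ z′ → Y x y z ≡ Y x′ y′ z′
Y-cong refl refl refl = refl

-- Preservation of the invariant by one reduction.

module _ {n m : ℕ} {G : Grid (suc m)} (inv : RowInvariant n (suc m) G) where
  open RowInvariant inv

  y₁₂ y₈ y₄ : ℕ → ℚ⁺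
  y₁₂ d = Δ (l d) (b d) (b d)
  y₈  d = Δ (b d) (l d) (b d)
  y₄  d = Δ (b d) (b d) (l d)

  -- `(r′ , d′)` is a triangle of the old grid; `(r , d)` only indexes the region of the reduced
  -- grid and may have `d = 0`.
  module _ {r d r′ d′ : ℕ} .{p : 1 ≤ d′} .{q : d′ ≤ r′} .{u : r′ ≤ suc m}
           (reg : Region n m r d) (d′≤1+d : d′ ≤ suc d)
           (r≤r′ : r ≤ r′) (r′≤2+r : r′ ≤ 2 ℕ.+ r) where

    private
      reg′ : Region n (suc m) r′ d′
      reg′ = Region-shift reg d′≤1+d r≤r′ r′≤2+r

    Y₁₂≡ : Y₁₂ G r′ d′ p q u ≡ y₁₂ d′
    Y₁₂≡ = Δ-cong (G-L r′ d′ p q u reg′) (G-R r′ d′ p q u reg′) (G-B r′ d′ p q u reg′)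

    Y₈≡ : Y₈ G r′ d′ p q u ≡ y₈ d′
    Y₈≡ = Δ-cong (G-B r′ d′ p q u reg′) (G-L r′ d′ p q u reg′) (G-R r′ d′ p q u reg′)

    Y₄≡ : Y₄ G r′ d′ p q u ≡ y₄ d′
    Y₄≡ = Δ-cong (G-R r′ d′ p q u reg′) (G-B r′ d′ p q u reg′) (G-L r′ d′ p q u reg′)

  -- Region n m r 0 reaches one row higher on the first diagonal than
  -- Region n m r 1 does, and this is the row of L_s.
  reduce-L₁ : ∀ r .p .q .u → Region n m r 0 →
              reduce G (tri r 1 p q u) L ≡ y₈ 1 + y₁₂ 1
  reduce-L₁ r p q u reg =
    cong₂ _+_ (Y₈≡ reg ≤-refl ≤-refl (ℕ.m≤n+m r 2))
              (Y₁₂≡ reg ≤-refl (ℕ.n≤1+n r) (ℕ.n≤1+n (suc r)))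

  reduce-L₁<1 : ∀ r .p .q .u → Region n m r 0 →
                value (reduce G (tri r 1 p q u) L) <ℚ 1ℚ
  reduce-L₁<1 r p q u reg =
    subst (λ x → value x <ℚ 1ℚ) (sym (reduce-L₁ r p q u reg))
          (ℚ.<-≤-trans (Δ+Δ<l (l 1) (b 1)) l₁≤1)

  reduced-l : ℕ → ℚ⁺
  reduced-l 0             = 1ℚ⁺  -- there is no diagonal 0
  reduced-l 1             = y₈ 1 + y₁₂ 1
  reduced-l (suc (suc e)) = Y (y₄ (suc e)) (y₈ (suc (suc e))) (y₁₂ (suc (suc e)))

  -- Opaque because a with-abstraction normalises its goal.
  opaque
    reduced-b : ℕ → ℚ⁺
    reduced-b d = Y (y₈ (suc d)) (y₁₂ (suc d)) (y₄ d)

    -- Equal right and base labels make `y₈` and `y₁₂` equal, so the formulas for the new base and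
    -- right labels coincide and a single `b` suffices again.
    reduced-b-base : ∀ d → Y (y₁₂ (suc d)) (y₄ d) (y₈ (suc d)) ≡ reduced-b d
    reduced-b-base d = begin
      Y (y₁₂ (suc d)) (y₄ d) (y₈ (suc d))  ≡⟨ Y-swap (y₁₂ (suc d)) (y₄ d) (y₈ (suc d)) ⟩
      Y (y₁₂ (suc d)) (y₈ (suc d)) (y₄ d)  ≡⟨ Y-cong {z = y₄ d} (sym y₈≡y₁₂) y₈≡y₁₂ refl ⟩
      Y (y₈ (suc d)) (y₁₂ (suc d)) (y₄ d)  ∎
      where
      open ≡-Reasoning
      y₈≡y₁₂ : y₈ (suc d) ≡ y₁₂ (suc d)
      y₈≡y₁₂ = Δ-swap (b (suc d)) (l (suc d)) (b (suc d))

    Y-right : ∀ {r d} .{p q u p′ q′ u′ p″ q″ u″} → Region n m r d →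
              Y (Y₈ G r (suc d) p q u) (Y₁₂ G (suc r) (suc d) p′ q′ u′)
                (Y₄ G r d p″ q″ u″) ≡ reduced-b d
    Y-right {r} {d} reg =
      Y-cong (Y₈≡ reg ≤-refl ≤-refl (ℕ.m≤n+m r 2))
             (Y₁₂≡ reg ≤-refl (ℕ.n≤1+n r) (ℕ.n≤1+n (suc r)))
             (Y₄≡ reg (ℕ.n≤1+n d) ≤-refl (ℕ.m≤n+m r 2))

    Y-base : ∀ {r d} .{p q u p′ q′ u′ p″ q″ u″} → Region n m r d →
             Y (Y₁₂ G (suc (suc r)) (suc d) p q u) (Y₄ G (suc r) d p′ q′ u′)
               (Y₈ G (suc r) (suc d) p″ q″ u″) ≡ reduced-b d
    Y-base {r} {d} reg = trans
      (Y-cong (Y₁₂≡ reg ≤-refl (ℕ.m≤n+m r 2) ≤-refl)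
              (Y₄≡ reg (ℕ.n≤1+n d) (ℕ.n≤1+n r) (ℕ.n≤1+n (suc r)))
              (Y₈≡ reg ≤-refl (ℕ.n≤1+n r) (ℕ.n≤1+n (suc r))))
      (reduced-b-base d)

  reduce-L : ∀ r d .p .q .u → Region n m r d →
             reduce G (tri r d p q u) L ≡ reduced-l d
  reduce-L r 0 () q u reg
  reduce-L r 1 p q u (h , h′) =
    -- Lowering the diagonal to 0 only weakens the first bound of the region.
    reduce-L₁ r p q u (ℕ.≤-trans (ℕ.+-monoʳ-≤ n z≤n) h , h′)
  reduce-L r (suc (suc e)) p q u reg =
    Y-cong (Y₄≡ reg (ℕ.m≤n+m (suc e) 2) ≤-refl (ℕ.m≤n+m r 2))
           (Y₈≡ reg (ℕ.n≤1+n _) ≤-refl (ℕ.m≤n+m r 2))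
           (Y₁₂≡ reg (ℕ.n≤1+n _) (ℕ.n≤1+n r) (ℕ.n≤1+n (suc r)))

  -- reduce matches on the diagonal before the side, so it unfolds only after
  -- the case split d = 1, d ≥ 2.
  reduce-R : m ℕ.< n → ∀ r d .p .q .u → Region n m r d →
             reduce G (tri r d p q u) R ≡ reduced-b d
  reduce-R m<n r 0 () q u reg
  reduce-R m<n r 1 p q u reg with 1 ℕ.<? r
  ... | yes _  = Y-right reg
  ... | no d≮r = contradiction (Region⇒d<r m<n reg) d≮r
  reduce-R m<n r d@(suc (suc _)) p q u reg with d ℕ.<? r
  ... | yes _  = Y-right reg
  ... | no d≮r = contradiction (Region⇒d<r m<n reg) d≮r

  reduce-B : m ℕ.< n → ∀ r d .p .q .u → Region n m r d →
             reduce G (tri r d p q u) B ≡ reduced-b d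
  reduce-B m<n r 0 () q u reg
  reduce-B m<n r 1 p q u reg with r ℕ.<? m
  ... | yes _  = Y-base reg
  ... | no r≮m = contradiction (Region⇒r<m m<n reg) r≮m
  reduce-B m<n r d@(suc (suc _)) p q u reg with r ℕ.<? m
  ... | yes _  = Y-base reg
  ... | no r≮m = contradiction (Region⇒r<m m<n reg) r≮m

  reduce-rowInvariant : m ℕ.< n → RowInvariant n m (reduce G)
  reduce-rowInvariant m<n = record
    { l    = reduced-l
    ; b    = reduced-b
    ; l₁≤1 = ℚ.<⇒≤ (ℚ.<-≤-trans (Δ+Δ<l (l 1) (b 1)) l₁≤1)
    ; G-L  = reduce-L
    ; G-R  = reduce-R m<n
    ; G-B  = reduce-B m<n
    }

-- Induction over the reductions.

ones-rowInvariant : ∀ n → RowInvariant n n (ones n)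
ones-rowInvariant n = record
  { l    = λ _ → 1ℚ⁺
  ; b    = λ _ → 1ℚ⁺
  ; l₁≤1 = ℚ.≤-refl
  ; G-L  = λ _ _ _ _ _ _ → refl
  ; G-R  = λ _ _ _ _ _ _ → refl
  ; G-B  = λ _ _ _ _ _ _ → refl
  }

reduceTo-rowInvariant : ∀ {n m} (m≤n : m ≤‴ n) →
                        RowInvariant n m (reduceTo m≤n (ones n))
reduceTo-rowInvariant {n} ≤‴-refl = ones-rowInvariant n
reduceTo-rowInvariant (≤‴-step m<n) =
  reduce-rowInvariant (reduceTo-rowInvariant m<n) (ℕ.≤‴⇒≤ m<n)

-- The invariant of the final grid gives only a weak bound, and on diagonal 1 only from row
-- `n − m + 1` on. Treating the last reduction separately yields strictness and also reaches row
-- `n − m`.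
reduceTo-L₁<1 : ∀ {n m} (m≤n : m ≤‴ n) → m ℕ.< n → ∀ r .p .q .u → Region n m r 0 →
                value (reduceTo m≤n (ones n) (tri r 1 p q u) L) <ℚ 1ℚ
reduceTo-L₁<1 ≤‴-refl n<n = contradiction n<n (ℕ.n≮n _)
reduceTo-L₁<1 (≤‴-step m<n) _ = reduce-L₁<1 (reduceTo-rowInvariant m<n)

-- For `m = n ∸ s`, row `s` meets the first bound with equality, and the second amounts to
-- `s + s + s ≤ n`.
4s≤n⇒Region : ∀ {s n} → 4 *ℕ s ≤ n → Region n (n ∸ s) s 0
4s≤n⇒Region {s} {n} 4s≤n =
  (begin
    n ℕ.+ 0        ≡⟨ ℕ.+-identityʳ n ⟩
    n              ≤⟨ ℕ.m≤n+m∸n n s ⟩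
    s ℕ.+ (n ∸ s)  ∎) ,
  (begin
    s ℕ.+ n                ≤⟨ ℕ.+-monoʳ-≤ s (ℕ.m≤n+m∸n n s) ⟩
    s ℕ.+ (s ℕ.+ (n ∸ s))  ≡⟨ ℕ.+-assoc s s (n ∸ s) ⟨
    s ℕ.+ s ℕ.+ (n ∸ s)    ≤⟨ ℕ.+-monoˡ-≤ (n ∸ s) 2s≤n∸s ⟩
    (n ∸ s) ℕ.+ (n ∸ s)    ∎)
  where
  open ℕ.≤-Reasoning
  2s≤n∸s : s ℕ.+ s ≤ n ∸ s
  2s≤n∸s = ℕ.m+n≤o⇒m≤o∸n (s ℕ.+ s) (begin
    s ℕ.+ s ℕ.+ s          ≡⟨ ℕ.+-assoc s s s ⟩
    s ℕ.+ (s ℕ.+ s)        ≤⟨ ℕ.+-monoʳ-≤ s (ℕ.+-monoʳ-≤ s (ℕ.m≤m+n s _)) ⟩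
    4 *ℕ s                 ≤⟨ 4s≤n ⟩
    n                      ∎)

corollary7p2 : ∀ (s : ℕ) (1≤s : 1 ≤ s) (n : ℕ) (4s≤n : 4 *ℕ s ≤ n) →
    value (T n (n ∸ s) (m∸n≤m n s) (tri s 1 ≤-refl 1≤s (4s≤n⇒s≤n∸s 4s≤n)) L) <ℚ 1ℚ
corollary7p2 s 1≤s n 4s≤n =
  reduceTo-L₁<1 (ℕ.≤⇒≤‴ (m∸n≤m n s)) n∸s<n s ≤-refl 1≤s (4s≤n⇒s≤n∸s 4s≤n)
                (4s≤n⇒Region 4s≤n)
  where
  n∸s<n : n ∸ s ℕ.< n
  -- The right-hand `n` is read as `n ∸ 0`, and `1≤s` as `0 < s`.
  n∸s<n = ℕ.∸-monoʳ-< 1≤s (ℕ.≤-trans (ℕ.m≤m+n s _) 4s≤n)
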